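{- Let $r\ge 0$ be an integer and let $n=\prod_{i=1}^{r}p_i^{e_i}$, where $p_1,\dots,p_r$ are distinct primes and $e_i\in\mathbb{Z}_{>0}$. Let $D_n$ be the set of positive divisors of $n$ ordered by divisibility. Then in the ruler game on $D_n$, the Grundy value of $y=p_1^{x_1}\cdots p_r^{x_r}\in D_n$ (with $0\le x_i\le e_i$) is \[ g(y)=h(x_1+1)\otimes h(x_2+1)\otimes\cdots\otimes h(x_r+1), \] where $h(x)=2^{v_2(x)}$ and $v_2(x)$ is the exponent of the largest power of $2$ dividing $x$.
   Context: Coin-turning games: let $X$ be a finite poset and $\mathcal{T}$ a family of nonempty subsets of $X$, each having a maximum element. In the game $\mathcal{G}(X,\mathcal{T})$ a position is a subset $H\subseteq X$ (the heads-up coins); a move from $H$ chooses $T\in\mathcal{T}$ with $\max T\in H$ and replaces $H$ by the symmetric difference $H\,\triangle\,T$; a player unable to move loses (normal play). The Grundy value $g(x)$ of $x\in X$ is the Sprague–Grundy value of the position $\{x\}$; equivalently $g(x)=\operatorname{mex}\{\bigoplus_{t\in T\setminus\{x\}}g(t) : T\in\mathcal{T},\ \max T=x\}$. The ruler on $X$ is the game $\mathcal{G}(X,\mathcal{I})$ where $\mathcal{I}$ is the set of all closed intervals $[a,b]=\{t\in X: a\le t\le b\}$ with $a\le b$ in $X$. Here $\oplus$ is nim-sum (bitwise XOR), $\operatorname{mex}(S)$ is the least nonnegative integer not in $S$, and $\otimes$ is Conway's nim-multiplication on nonnegative integers, defined recursively by $a\otimes b=\operatorname{mex}\{(a'\otimes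 b)\oplus(a\otimes b')\oplus(a'\otimes b') : a'<a,\ b'<b\}$. For $r=0$ (so $n=1$) the empty nim-product is interpreted as $1$. -}

module Defs where

open import Data.Nat using (ℕ; zero; suc; _+_; _*_; _^_; _/_; _%_; _≡ᵇ_)
open import Data.Nat.Divisibility using (_∣?_)
open import Data.Bool using (Bool; true; false; if_then_else_; _∨_; _∧_; not)
open import Data.List using (List; []; _∷_; map; filter; length; upTo; applyUpTo; concatMap; foldr)
open import Data.Fin using (Fin) renaming (zero to fzero; suc to fsuc)
open import Relation.Nullary.Decidable using (_×-dec_; ¬?)
open import Data.Nat using (_≟_)

-- nim-sum (bitwise XOR), by recursion on binary digits (fuel = a + b suffices)
xorF : ℕ → ℕ → ℕ → ℕ
xorF zero    a b = 0
xorF (suc f) a b =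
  (if (a % 2) ≡ᵇ (b % 2) then 0 else 1) + 2 * xorF f (a / 2) (b / 2)

_⊕_ : ℕ → ℕ → ℕ
a ⊕ b = xorF (a + b) a b

infixl 6 _⊕_

xorList : List ℕ → ℕ
xorList = foldr _⊕_ 0

-- mex of a list: least natural number not in the list (it is ≤ length)
memb : ℕ → List ℕ → Bool
memb k []       = false
memb k (x ∷ xs) = (x ≡ᵇ k) ∨ memb k xs

mexAux : ℕ → ℕ → List ℕ → ℕ
mexAux zero    k l = k
mexAux (suc f) k l = if memb k l then mexAux f (suc k) l else k

mex : List ℕ → ℕ
mex l = mexAux (length l) 0 l

-- Conway nim-multiplication:
-- a ⊗ b = mex { (a'⊗b) ⊕ (a⊗b') ⊕ (a'⊗b') : a' < a, b' < b }
-- (recursion on a + b, via fuel)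
nimMulF : ℕ → ℕ → ℕ → ℕ
nimMulF zero    a b = 0
nimMulF (suc f) a b =
  mex (concatMap (λ a' → map (λ b' →
         nimMulF f a' b ⊕ nimMulF f a b' ⊕ nimMulF f a' b') (upTo b)) (upTo a))

_⊗_ : ℕ → ℕ → ℕ
a ⊗ b = nimMulF (a + b) a b

infixl 7 _⊗_

v2F : ℕ → ℕ → ℕ
v2F zero    x = 0
v2F (suc f) x =
  if x ≡ᵇ 0 then 0 else (if (x % 2) ≡ᵇ 0 then suc (v2F f (x / 2)) else 0)

v2 : ℕ → ℕ
v2 x = v2F x x

h : ℕ → ℕ
h x = 2 ^ v2 x

prodFin : (r : ℕ) → (Fin r → ℕ) → ℕ
prodFin zero    f = 1
prodFin (suc r) f = f fzero * prodFin r (λ i → f (fsuc i))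

nimProdFin : (r : ℕ) → (Fin r → ℕ) → ℕ
nimProdFin zero    f = 1
nimProdFin (suc r) f = f fzero ⊗ nimProdFin r (λ i → f (fsuc i))

divisors : ℕ → List ℕ
divisors n = filter (λ d → d ∣? n) (applyUpTo suc n)

-- Ruler game on the poset (D_n, ∣): the moves with maximum b are the closed
-- intervals [a,b] = {t ∈ D_n : a ∣ t ∧ t ∣ b} for a ∈ D_n, a ∣ b, and
--   g(b) = mex { ⊕_{t ∈ [a,b], t ≠ b} g(t) : a ∈ D_n, a ∣ b }.
-- Well-founded since t ∣ b, t ≠ b, b ≥ 1 forces t < b; recursion via fuel.
rulerGrundyF : ℕ → ℕ → ℕ → ℕ
rulerGrundyF zero    n b = 0
rulerGrundyF (suc f) n b =
  mex (map (λ a → xorList (map (rulerGrundyF f n)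
          (filter (λ t → (a ∣? t) ×-dec ((t ∣? b) ×-dec ¬? (t ≟ b))) (divisors n))))
       (filter (λ a → a ∣? b) (divisors n)))

rulerGrundy : ℕ → ℕ → ℕ
rulerGrundy n b = rulerGrundyF b n b

{-# OPTIONS --safe #-}
module Submission where

-- Nim-addition and nim-multiplication are characterised by their options: the numbers below
-- a ⊕ b are of the form a′ ⊕ b or a ⊕ b′, and those below a ⊗ b are of the form
-- a′b ⊕ ab′ ⊕ a′b′ = ab ⊕ (a ⊕ a′)(b ⊕ b′).  Distributivity follows from this.
-- Divisors correspond to exponent vectors and intervals to boxes, so if the formula holds below
-- y, distributivity shows that the move [a , y] leads to the value g(y) ⊕ ∏ᵢ (P(yᵢ + 1) ⊕ P(aᵢ)),
-- where P(m) = h(1) ⊕ … ⊕ h(m) is the Gray code.  Since P is injective, no such value equals g(y).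
-- Conversely P(yᵢ + 1) ⊕ P(aᵢ) takes all values c ⊕ h(yᵢ + 1) with c < h(yᵢ + 1), and the options
-- of a nim-product are exactly such that every number below g(y) is then reached by some a.

open import Defs
open import Algebra.Bundles using (CommutativeMonoid)
open import Data.Bool using (Bool; true; false; if_then_else_; _xor_; not; T)
open import Data.Bool.Properties using (xor-assoc; xor-comm; xor-same; xor-identityʳ)
open import Data.Fin using (Fin) renaming (zero to fzero; suc to fsuc)
import Data.Fin.Properties as Fin
open import Data.List using (List; []; _∷_; _++_; length; lookup; map; concat; concatMap; filter; upTo; applyUpTo; applyDownFrom; cartesianProductWith)
open import Data.List.Membership.Propositional using (_∈_; _∉_; find; lose)
open import Data.List.Membership.Propositional.Properties
open import Data.List.Membership.Propositional.Properties.WithK using (unique∧set⇒bag)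
open import Data.List.Properties using (map-cong-local; map-++; map-∘)
open import Data.List.Relation.Binary.BagAndSetEquality using (∼bag⇒↭)
open import Data.List.Relation.Binary.Permutation.Propositional using (_↭_)
import Data.List.Relation.Binary.Permutation.Propositional as Perm
import Data.List.Relation.Binary.Permutation.Propositional.Properties as Perm
import Data.List.Relation.Unary.All as All
open import Data.List.Relation.Unary.All.Properties using (all-upTo)
open import Data.List.Relation.Unary.AllPairs using ([]; _∷_)
open import Data.List.Relation.Unary.Any using (here; there; index)
open import Data.List.Relation.Unary.Any.Properties using (lookup-index)
open import Data.List.Relation.Unary.Unique.Propositional using (Unique)
import Data.List.Relation.Unary.Unique.Propositional.Properties as Unique
open import Data.Nat using (ℕ; zero; suc; pred; _+_; _*_; _∸_; _^_; _/_; _%_; _≡ᵇ_; _≤_; _<_; _≟_; z≤n; s≤s; s≤s⁻¹; z<s; NonZero; ≢-nonZero⁻¹)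
open import Data.Nat.Coprimality using (Coprime; coprime-divisor) renaming (sym to coprime-sym)
open import Data.Nat.Divisibility
open import Data.Nat.DivMod using (m≡m%n+[m/n]*n; m%n<n; [m+kn]%n≡m%n; m*n/n≡m; m/n<m; m/n≤m; +-distrib-/-∣ʳ)
open import Data.Nat.Induction using (<-rec)
open import Data.Nat.Primality using (Prime; euclidsLemma; prime⇒irreducible; prime⇒nonZero; ¬prime[1])
open import Data.Nat.Properties
open import Data.Product using (∃; ∃₂; _×_; _,_; proj₁; proj₂)
open import Data.Sum using (_⊎_; inj₁; inj₂; [_,_]′)
open import Data.Unit using (tt)
open import Data.Vec using (Vec; []; _∷_; tabulate)
open import Data.Vec.Properties using (∷-injective)
open import Data.Vec.Relation.Binary.Pointwise.Inductive using (Pointwise; []; _∷_; tabulate⁺) renaming (refl to pointwise-refl; trans to pointwise-trans)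
open import Function using (_∘_; id; mk⇔)
open import Relation.Binary.Definitions using (tri<; tri≈; tri>)
open import Relation.Binary.PropositionalEquality
open import Relation.Nullary using (contradiction; ¬_; yes; no)
open import Relation.Nullary.Decidable using (_×-dec_; ¬?)

-- Binary digits

infixr 8 _⦂_

bit : Bool → ℕ
bit false = 0
bit true  = 1

_⦂_ : Bool → ℕ → ℕ
b ⦂ n = bit b + 2 * n

-- A view of a number through its last binary digit: matching on `binary n` takes the place of
-- reasoning about `%` and `/`.
data Binary : ℕ → Set where
  _⦂ᵛ_ : ∀ b n → Binary (b ⦂ n)

⦂-% : ∀ b n → (b ⦂ n) % 2 ≡ bit b
⦂-% b n rewrite *-comm 2 n = trans ([m+kn]%n≡m%n (bit b) n 2) (bit-% b)
  where
  bit-% : ∀ b → bit b % 2 ≡ bit b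
  bit-% false = refl
  bit-% true  = refl

⦂-/ : ∀ b n → (b ⦂ n) / 2 ≡ n
⦂-/ b n rewrite *-comm 2 n =
  trans (+-distrib-/-∣ʳ (bit b) (divides n refl)) (cong₂ _+_ (bit-/ b) (m*n/n≡m n 2))
  where
  bit-/ : ∀ b → bit b / 2 ≡ 0
  bit-/ false = refl
  bit-/ true  = refl

binary : ∀ n → Binary n
binary n = subst Binary (sym (trans (m≡m%n+[m/n]*n n 2) (cong (n % 2 +_) (*-comm (n / 2) 2))))
  (digit (n % 2) (m%n<n n 2))
  where
  digit : ∀ d → d < 2 → Binary (d + 2 * (n / 2))
  digit 0 _ = false ⦂ᵛ (n / 2)
  digit 1 _ = true ⦂ᵛ (n / 2)
  digit (suc (suc _)) (s≤s (s≤s ()))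

n<true⦂n : ∀ n → n < true ⦂ n
n<true⦂n n = s≤s (m≤m+n n _)

1+n<false⦂1+n : ∀ n → suc n < false ⦂ suc n
1+n<false⦂1+n n = m<m+n (suc n) z<s

binary-induction : (P : ℕ → Set) → P 0 → (∀ b n → P n → P (b ⦂ n)) → ∀ n → P n
binary-induction P P0 P⦂ = <-rec P λ n rec → step n rec (binary n)
  where
  step : ∀ n → (∀ {m} → m < n → P m) → Binary n → P n
  -- `false ⦂ zero` is 0 itself, so removing its digit would not descend.
  step _ rec (false ⦂ᵛ zero)  = P0
  step _ rec (false ⦂ᵛ suc n) = P⦂ false (suc n) (rec (1+n<false⦂1+n n))
  step _ rec (true ⦂ᵛ n)      = P⦂ true n (rec (n<true⦂n n))

⦂-mono-< : ∀ b c {m n} → m < n → b ⦂ m < c ⦂ n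
⦂-mono-< b c {m} {n} m<n = begin-strict
  b ⦂ m         ≤⟨ +-monoˡ-≤ (2 * m) (bit≤1 b) ⟩
  1 + 2 * m     <⟨ n<1+n _ ⟩
  2 + 2 * m     ≡⟨ *-suc 2 m ⟨
  2 * suc m     ≤⟨ *-monoʳ-≤ 2 m<n ⟩
  2 * n         ≤⟨ m≤n+m (2 * n) (bit c) ⟩
  c ⦂ n         ∎
  where
  open ≤-Reasoning
  bit≤1 : ∀ b → bit b ≤ 1
  bit≤1 false = z≤n
  bit≤1 true  = ≤-refl

⦂-<-inv : ∀ b c m n → b ⦂ m < c ⦂ n → m < n ⊎ (m ≡ n × b ≡ false × c ≡ true)
⦂-<-inv b c m n lt with <-cmp m n
... | tri< m<n _ _ = inj₁ m<n
... | tri> _ _ n<m = contradiction (⦂-mono-< c b n<m) (<-asym lt)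
⦂-<-inv false true  m .m lt | tri≈ _ refl _ = inj₂ (refl , refl , refl)
⦂-<-inv false false m .m lt | tri≈ _ refl _ = contradiction lt (<-irrefl refl)
⦂-<-inv true  true  m .m lt | tri≈ _ refl _ = contradiction lt (<-irrefl refl)
⦂-<-inv true  false m .m lt | tri≈ _ refl _ = contradiction (<⇒≤ lt) (<⇒≱ ≤-refl)

-- Nim-sum

xorF-zero : ∀ f → xorF f 0 0 ≡ 0
xorF-zero zero    = refl
xorF-zero (suc f) = cong (2 *_) (xorF-zero f)

/2+/2≤ : ∀ f a b → a + b ≤ suc f → a / 2 + b / 2 ≤ f
/2+/2≤ f zero zero le = z≤n
/2+/2≤ f zero b@(suc _) le = s≤s⁻¹ (≤-trans (m/n<m b 2 ≤-refl) le)
/2+/2≤ f a@(suc _) b le = s≤s⁻¹ (≤-trans (+-mono-<-≤ (m/n<m a 2 ≤-refl) (m/n≤m b 2)) le)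

-- Halving both arguments lowers a positive sum `a + b`, so fuel of at least `a + b` lasts until
-- both are 0.
xorF-irrelevant : ∀ f g a b → a + b ≤ f → a + b ≤ g → xorF f a b ≡ xorF g a b
xorF-irrelevant zero g zero zero le₁ le₂ = sym (xorF-zero g)
xorF-irrelevant (suc f) zero zero zero le₁ le₂ = xorF-zero (suc f)
xorF-irrelevant (suc f) (suc g) a b le₁ le₂ =
  cong (λ z → (if (a % 2) ≡ᵇ (b % 2) then 0 else 1) + 2 * z)
    (xorF-irrelevant f g (a / 2) (b / 2) (/2+/2≤ f a b le₁) (/2+/2≤ g a b le₂))

⊕-⦂ : ∀ b c m n → (b ⦂ m) ⊕ (c ⦂ n) ≡ (b xor c) ⦂ (m ⊕ n)
⊕-⦂ b c m n = begin
  -- One extra unit of fuel lets `xorF` emit its last digit by computation.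
  xorF f x y                ≡⟨ xorF-irrelevant f (suc f) x y ≤-refl (n≤1+n f) ⟩
  digit (x % 2) (y % 2) + 2 * xorF f (x / 2) (y / 2)
    ≡⟨ cong₂ (λ d e → digit d e + 2 * xorF f (x / 2) (y / 2)) (⦂-% b m) (⦂-% c n) ⟩
  digit (bit b) (bit c) + 2 * xorF f (x / 2) (y / 2)
    ≡⟨ cong₂ (λ d e → digit (bit b) (bit c) + 2 * xorF f d e) (⦂-/ b m) (⦂-/ c n) ⟩
  digit (bit b) (bit c) + 2 * xorF f m n
    ≡⟨ cong₂ (λ d z → d + 2 * z) (digit-xor b c)
         (xorF-irrelevant f (m + n) m n (+-mono-≤ (m≤b⦂m b m) (m≤b⦂m c n)) ≤-refl) ⟩
  (b xor c) ⦂ (m ⊕ n)       ∎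
  where
  open ≡-Reasoning
  x = b ⦂ m
  y = c ⦂ n
  f = x + y
  digit : ℕ → ℕ → ℕ
  digit d e = if d ≡ᵇ e then 0 else 1
  digit-xor : ∀ b c → digit (bit b) (bit c) ≡ bit (b xor c)
  digit-xor false false = refl
  digit-xor false true  = refl
  digit-xor true  false = refl
  digit-xor true  true  = refl
  m≤b⦂m : ∀ b m → m ≤ b ⦂ m
  m≤b⦂m b m = ≤-trans (m≤m+n m _) (m≤n+m (2 * m) (bit b))

⊕-identityˡ : ∀ a → 0 ⊕ a ≡ a
⊕-identityˡ = binary-induction _ refl λ b n ih →
  trans (⊕-⦂ false b 0 n) (cong (b ⦂_) ih)

⊕-comm : ∀ a b → a ⊕ b ≡ b ⊕ a
⊕-comm = binary-induction _ (binary-induction _ refl (λ b n ih → step false b 0 n ih))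
  λ b n ih m → elim b n ih (binary m)
  where
  step : ∀ b c m n → m ⊕ n ≡ n ⊕ m → (b ⦂ m) ⊕ (c ⦂ n) ≡ (c ⦂ n) ⊕ (b ⦂ m)
  step b c m n ih = trans (⊕-⦂ b c m n) (trans (cong₂ _⦂_ (xor-comm b c) ih) (sym (⊕-⦂ c b n m)))
  elim : ∀ b n → (∀ m → n ⊕ m ≡ m ⊕ n) → ∀ {m} → Binary m → (b ⦂ n) ⊕ m ≡ m ⊕ (b ⦂ n)
  elim b n ih (c ⦂ᵛ m) = step b c n m (ih m)

⊕-identityʳ : ∀ a → a ⊕ 0 ≡ a
⊕-identityʳ a = trans (⊕-comm a 0) (⊕-identityˡ a)

⊕-assoc : ∀ a b c → (a ⊕ b) ⊕ c ≡ a ⊕ (b ⊕ c)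
⊕-assoc = binary-induction _
  (λ b c → trans (cong (_⊕ c) (⊕-identityˡ b)) (sym (⊕-identityˡ (b ⊕ c))))
  λ x a ih b c → step x a ih (binary b) (binary c)
  where
  open ≡-Reasoning
  step : ∀ x a → (∀ b c → (a ⊕ b) ⊕ c ≡ a ⊕ (b ⊕ c)) → ∀ {b c} → Binary b → Binary c →
         ((x ⦂ a) ⊕ b) ⊕ c ≡ (x ⦂ a) ⊕ (b ⊕ c)
  step x a ih (y ⦂ᵛ b) (z ⦂ᵛ c) = begin
    ((x ⦂ a) ⊕ (y ⦂ b)) ⊕ (z ⦂ c)    ≡⟨ cong (_⊕ (z ⦂ c)) (⊕-⦂ x y a b) ⟩
    ((x xor y) ⦂ (a ⊕ b)) ⊕ (z ⦂ c)  ≡⟨ ⊕-⦂ (x xor y) z (a ⊕ b) c ⟩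
    ((x xor y) xor z) ⦂ (a ⊕ b ⊕ c)  ≡⟨ cong₂ _⦂_ (xor-assoc x y z) (ih b c) ⟩
    (x xor (y xor z)) ⦂ (a ⊕ (b ⊕ c)) ≡⟨ ⊕-⦂ x (y xor z) a (b ⊕ c) ⟨
    (x ⦂ a) ⊕ ((y xor z) ⦂ (b ⊕ c))  ≡⟨ cong ((x ⦂ a) ⊕_) (⊕-⦂ y z b c) ⟨
    (x ⦂ a) ⊕ ((y ⦂ b) ⊕ (z ⦂ c))    ∎

⊕-self : ∀ a → a ⊕ a ≡ 0
⊕-self = binary-induction _ refl λ b n ih → trans (⊕-⦂ b b n n) (cong₂ _⦂_ (xor-same b) ih)

⊕-cancelʳ : ∀ a b → a ⊕ b ⊕ b ≡ a
⊕-cancelʳ a b = trans (⊕-assoc a b b) (trans (cong (a ⊕_) (⊕-self b)) (⊕-identityʳ a))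

⊕-cancelˡ : ∀ a b → a ⊕ (a ⊕ b) ≡ b
⊕-cancelˡ a b = trans (sym (⊕-assoc a a b)) (trans (cong (_⊕ b) (⊕-self a)) (⊕-identityˡ b))

⊕-injectiveʳ : ∀ c {a b} → a ⊕ c ≡ b ⊕ c → a ≡ b
⊕-injectiveʳ c {a} {b} eq = trans (sym (⊕-cancelʳ a c)) (trans (cong (_⊕ c) eq) (⊕-cancelʳ b c))

⊕≡0⇒≡ : ∀ {a b} → a ⊕ b ≡ 0 → a ≡ b
⊕≡0⇒≡ {a} {b} eq = ⊕-injectiveʳ b (trans eq (sym (⊕-self b)))

-- That is, v = a′ ⊕ b with a′ < a or v = a ⊕ b′ with b′ < b: the only candidates are a′ = v ⊕ b, b′ = a ⊕ v.
<⊕⇒option : ∀ a b v → v < a ⊕ b → v ⊕ b < a ⊎ a ⊕ v < b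
<⊕⇒option = binary-induction _
  (λ b v lt → inj₂ (subst₂ _<_ (sym (⊕-identityˡ v)) (⊕-identityˡ b) lt))
  λ x a ih b v → step x a ih (binary b) (binary v)
  where
  step : ∀ x a → (∀ b v → v < a ⊕ b → v ⊕ b < a ⊎ a ⊕ v < b) →
         ∀ {b v} → Binary b → Binary v →
         v < (x ⦂ a) ⊕ b → v ⊕ b < x ⦂ a ⊎ (x ⦂ a) ⊕ v < b
  step x a ih (y ⦂ᵛ b) (z ⦂ᵛ v) lt
    rewrite ⊕-⦂ x y a b | ⊕-⦂ z y v b | ⊕-⦂ x z a v
    with ⦂-<-inv z (x xor y) v (a ⊕ b) lt
  ... | inj₁ v< with ih b v v<
  ...   | inj₁ p = inj₁ (⦂-mono-< (z xor y) x p)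
  ...   | inj₂ p = inj₂ (⦂-mono-< (x xor z) y p)
  -- Now v and the sum differ only in the last digit, which is 1 in the sum and hence in exactly one
  -- summand; that summand gets smaller by losing it.
  step true a ih (false ⦂ᵛ b) (false ⦂ᵛ v) lt | inj₂ (refl , refl , refl) =
    inj₁ (subst (λ m → 2 * m < true ⦂ a) (sym (⊕-cancelʳ a b)) ≤-refl)
  step false a ih (true ⦂ᵛ b) (false ⦂ᵛ v) lt | inj₂ (refl , refl , refl) =
    inj₂ (subst (λ m → 2 * m < true ⦂ b) (sym (⊕-cancelˡ a b)) ≤-refl)

-- Mex

memb⇒∈ : ∀ k l → memb k l ≡ true → k ∈ l
memb⇒∈ k (x ∷ l) eq with x ≡ᵇ k in x≡ᵇk
... | true  = here (sym (≡ᵇ⇒≡ x k (subst T (sym x≡ᵇk) tt)))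
... | false = there (memb⇒∈ k l eq)

¬memb⇒∉ : ∀ k l → memb k l ≡ false → k ∉ l
¬memb⇒∉ k (x ∷ l) eq k∈ with x ≡ᵇ k in x≡ᵇk
¬memb⇒∉ k (.k ∷ l) eq (here refl) | false = subst T x≡ᵇk (≡⇒≡ᵇ k k refl)
¬memb⇒∉ k (x ∷ l) eq (there k∈)   | false = ¬memb⇒∉ k l eq k∈

-- Pigeonhole on positions: in a shorter list two different numbers would occupy the same place.
-- Hence `length l` is enough fuel for `mex`.
initial-segment-≤-length : ∀ n (l : List ℕ) → (∀ {c} → c < n → c ∈ l) → n ≤ length l
initial-segment-≤-length n l below = ≮⇒≥ λ len<n →
  let position i = index (below (Fin.toℕ<n i))
      i , j , i<j , eq = Fin.pigeonhole len<n position
      value i = lookup-index (below (Fin.toℕ<n i))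
  in <⇒≢ i<j (trans (value i) (trans (cong (lookup l) eq) (sym (value j))))

extend-initial-segment : ∀ {k} {l : List ℕ} → (∀ {c} → c < k → c ∈ l) → k ∈ l →
                         ∀ {c} → c < suc k → c ∈ l
extend-initial-segment below k∈l c<1+k =
  [ below , (λ { refl → k∈l }) ]′ (m≤n⇒m<n∨m≡n (s≤s⁻¹ c<1+k))

mexAux-spec : ∀ f k l → (∀ {c} → c < k → c ∈ l) → length l ≤ k + f →
              mexAux f k l ∉ l × (∀ {c} → c < mexAux f k l → c ∈ l)
mexAux-spec zero k l below len≤ =
  -- Without fuel `length l ≤ k`; if k were in l as well, l would contain the `suc k` numbers up to
  -- k.
  (λ k∈l → <⇒≱ (initial-segment-≤-length (suc k) l (extend-initial-segment below k∈l))
                (subst (length l ≤_) (+-identityʳ k) len≤))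
  , below
mexAux-spec (suc f) k l below len≤ with memb k l in eq
... | false = ¬memb⇒∉ k l eq , below
... | true  = mexAux-spec f (suc k) l (extend-initial-segment below (memb⇒∈ k l eq))
  (subst (length l ≤_) (+-suc k f) len≤)

mex∉ : ∀ l → mex l ∉ l
mex∉ l = proj₁ (mexAux-spec (length l) 0 l (λ ()) ≤-refl)

<mex⇒∈ : ∀ l {c} → c < mex l → c ∈ l
<mex⇒∈ l = proj₂ (mexAux-spec (length l) 0 l (λ ()) ≤-refl)

mex-unique : ∀ l {m} → m ∉ l → (∀ {c} → c < m → c ∈ l) → mex l ≡ m
mex-unique l {m} m∉l below with <-cmp (mex l) m
... | tri< lt _ _ = contradiction (below lt) (mex∉ l)
... | tri≈ _ eq _ = eq
... | tri> _ _ gt = contradiction (<mex⇒∈ l gt) m∉l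

-- Nim-product

-- The multiplication is a parameter, so that `nimMulF f` and `_⊗_` can be compared on smaller
-- arguments.
nimOptions : (ℕ → ℕ → ℕ) → ℕ → ℕ → List ℕ
nimOptions _·_ a b =
  concatMap (λ a' → map (λ b' → (a' · b) ⊕ (a · b') ⊕ (a' · b')) (upTo b)) (upTo a)

nimOptions-cong : ∀ {_·_ _∘_ : ℕ → ℕ → ℕ} a b →
  (∀ {a' b'} → a' + b' < a + b → a' · b' ≡ a' ∘ b') →
  nimOptions _·_ a b ≡ nimOptions _∘_ a b
nimOptions-cong a b eq = cong concat (map-cong-local (All.map
  (λ a'<a → map-cong-local (All.map
    (λ b'<b → cong₂ _⊕_ (cong₂ _⊕_ (eq (+-monoˡ-< b a'<a)) (eq (+-monoʳ-< a b'<b)))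
                        (eq (+-mono-< a'<a b'<b)))
    (all-upTo b)))
  (all-upTo a)))

nimMulF-irrelevant : ∀ f g a b → a + b ≤ f → a + b ≤ g → nimMulF f a b ≡ nimMulF g a b
nimMulF-irrelevant zero    zero    a b le₁ le₂ = refl
nimMulF-irrelevant zero    (suc g) zero zero le₁ le₂ = refl
nimMulF-irrelevant (suc f) zero    zero zero le₁ le₂ = refl
nimMulF-irrelevant (suc f) (suc g) a b le₁ le₂ =
  cong mex (nimOptions-cong {nimMulF f} {nimMulF g} a b λ {a'} {b'} lt →
    nimMulF-irrelevant f g a' b' (s≤s⁻¹ (≤-trans lt le₁)) (s≤s⁻¹ (≤-trans lt le₂)))

⊗-unfold : ∀ a b → a ⊗ b ≡ mex (nimOptions _⊗_ a b)
⊗-unfold a b = trans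
  (nimMulF-irrelevant (a + b) (suc (a + b)) a b ≤-refl (n≤1+n _))
  (cong mex (nimOptions-cong {nimMulF (a + b)} {_⊗_} a b λ {a'} {b'} lt →
    nimMulF-irrelevant (a + b) (a' + b') a' b' (<⇒≤ lt) ≤-refl))

nimOption : ℕ → ℕ → ℕ → ℕ → ℕ
nimOption a b a' b' = a' ⊗ b ⊕ a ⊗ b' ⊕ a' ⊗ b'

<⊗⇒option : ∀ a b {c} → c < a ⊗ b → ∃₂ λ a' b' → a' < a × b' < b × c ≡ nimOption a b a' b'
<⊗⇒option a b c<
  with a' , a'∈ , c∈ ← find (∈-concatMap⁻ _ {xs = upTo a}
         (<mex⇒∈ (nimOptions _⊗_ a b) (subst (_ <_) (⊗-unfold a b) c<)))
  with b' , b'∈ , eq ← ∈-map⁻ _ c∈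
  = a' , b' , ∈-upTo⁻ a'∈ , ∈-upTo⁻ b'∈ , eq

option≢⊗ : ∀ {a b a' b'} → a' < a → b' < b → nimOption a b a' b' ≢ a ⊗ b
option≢⊗ {a} {b} {a'} {b'} a'<a b'<b eq =
  mex∉ (nimOptions _⊗_ a b) (subst (_∈ nimOptions _⊗_ a b) (trans eq (⊗-unfold a b))
    (∈-concatMap⁺ _ (lose (∈-upTo⁺ a'<a) (∈-map⁺ _ (∈-upTo⁺ b'<b)))))

⊗-zeroˡ : ∀ b → 0 ⊗ b ≡ 0
⊗-zeroˡ b = ⊗-unfold 0 b

⊗-zeroʳ : ∀ a → a ⊗ 0 ≡ 0
⊗-zeroʳ a with a ⊗ 0 in eq
... | zero  = refl
... | suc _ with () ← proj₁ (proj₂ (proj₂ (proj₂ (<⊗⇒option a 0 (subst (0 <_) (sym eq) z<s)))))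

-- For positive a and b the choice `a' = b' = 0` gives the option 0, which the mex avoids.
⊗-nonzero : ∀ {a b} → a ≢ 0 → b ≢ 0 → a ⊗ b ≢ 0
⊗-nonzero {a} {b} a≢0 b≢0 eq = option≢⊗ (n≢0⇒n>0 a≢0) (n≢0⇒n>0 b≢0)
  (trans (cong₂ (λ x y → x ⊕ y ⊕ 0) (⊗-zeroˡ b) (⊗-zeroʳ a)) (sym eq))

⊕-commutativeMonoid : CommutativeMonoid _ _
⊕-commutativeMonoid = record
  { isCommutativeMonoid = record
    { isMonoid = record
      { isSemigroup = record
        { isMagma = isMagma _⊕_ ; assoc = ⊕-assoc }
      ; identity = ⊕-identityˡ , ⊕-identityʳ }
    ; comm = ⊕-comm } }

open import Algebra.Solver.CommutativeMonoid ⊕-commutativeMonoid using (solve; _⊜_) renaming (_⊕_ to _∔_)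

-- With p, q, r, s standing for ab, a'b, ab', a'b', the conclusion has the shape of `nimOption`
-- after exchanging a with a'. The next two lemmas serve the exchange of b with b' and both
-- exchanges at once.
⊕-exchange₁ : ∀ p q r s → q ⊕ r ⊕ s ≡ p → p ⊕ s ⊕ r ≡ q
⊕-exchange₁ _ q r s refl =
  trans (cong (_⊕ r) (⊕-cancelʳ (q ⊕ r) s)) (⊕-cancelʳ q r)

⊕-exchange₂ : ∀ p q r s → q ⊕ r ⊕ s ≡ p → s ⊕ p ⊕ q ≡ r
⊕-exchange₂ p q r s eq = trans (cong (_⊕ q) (⊕-comm s p))
  (⊕-exchange₁ p r q s (trans (cong (_⊕ s) (⊕-comm r q)) eq))

⊕-exchange₃ : ∀ p q r s → q ⊕ r ⊕ s ≡ p → r ⊕ q ⊕ p ≡ s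
⊕-exchange₃ p q r s eq = trans
  (solve 3 (λ p q r → (r ∔ q) ∔ p ⊜ (p ∔ q) ∔ r) refl p q r)
  (⊕-exchange₁ p s r q (trans (solve 3 (λ q r s → (s ∔ r) ∔ q ⊜ (q ∔ r) ∔ s) refl q r s) eq))

-- The relation ab ⊕ a′b ⊕ ab′ ⊕ a′b′ ≠ 0 is symmetric in a, a′ and in b, b′,
-- so the order assumptions of option≢⊗ may be weakened to inequalities.
nimOption≢⊗ : ∀ {a b a' b'} → a' ≢ a → b' ≢ b → nimOption a b a' b' ≢ a ⊗ b
nimOption≢⊗ {a} {b} {a'} {b'} a'≢a b'≢b eq with <-cmp a' a | <-cmp b' b
... | tri≈ _ a'≡a _ | _ = a'≢a a'≡a
... | _ | tri≈ _ b'≡b _ = b'≢b b'≡b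
... | tri< a'<a _ _ | tri< b'<b _ _ = option≢⊗ a'<a b'<b eq
... | tri> _ _ a<a' | tri< b'<b _ _ =
  option≢⊗ a<a' b'<b (⊕-exchange₁ (a ⊗ b) (a' ⊗ b) (a ⊗ b') (a' ⊗ b') eq)
... | tri< a'<a _ _ | tri> _ _ b<b' =
  option≢⊗ a'<a b<b' (⊕-exchange₂ (a ⊗ b) (a' ⊗ b) (a ⊗ b') (a' ⊗ b') eq)
... | tri> _ _ a<a' | tri> _ _ b<b' =
  option≢⊗ a<a' b<b' (⊕-exchange₃ (a ⊗ b) (a' ⊗ b) (a ⊗ b') (a' ⊗ b') eq)

-- By induction the options of `a ⊗ b` and `b ⊗ a` agree one by one. If one product were smaller, it
-- would be an option of the other, hence one of its own options.
⊗-comm : ∀ a b → a ⊗ b ≡ b ⊗ a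
⊗-comm = <-rec _ λ a ihᵃ → <-rec _ λ b ihᵇ →
  let swap : ∀ {a' b'} → a' < a → b' < b → nimOption b a b' a' ≡ nimOption a b a' b'
      swap {a'} {b'} a'<a b'<b = trans
        (cong₂ _⊕_ (cong₂ _⊕_ (sym (ihᵇ b'<b)) (sym (ihᵃ a'<a b))) (sym (ihᵃ a'<a b')))
        (cong (_⊕ a' ⊗ b') (⊕-comm (a ⊗ b') (a' ⊗ b)))
  in ≤-antisym
    (≮⇒≥ λ lt → let a' , b' , a'<a , b'<b , eq = <⊗⇒option a b lt in
      option≢⊗ b'<b a'<a (trans (swap a'<a b'<b) (sym eq)))
    (≮⇒≥ λ lt → let b' , a' , b'<b , a'<a , eq = <⊗⇒option b a lt in
      option≢⊗ a'<a b'<b (trans (sym (swap a'<a b'<b)) (sym eq)))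

-- Distributivity of nim-multiplication over nim-sum

DistributesAt : ℕ → ℕ → ℕ → Set
DistributesAt a b c = a ⊗ (b ⊕ c) ≡ a ⊗ b ⊕ a ⊗ c

-- After three uses of distributivity `a' ⊗ c` occurs twice and cancels: translating b and b' by c
-- translates the option by `a ⊗ c`.
nimOption-⊕ : ∀ {a a' b b' c} → DistributesAt a' b c → DistributesAt a b' c → DistributesAt a' b' c →
  nimOption a (b ⊕ c) a' (b' ⊕ c) ≡ nimOption a b a' b' ⊕ a ⊗ c
nimOption-⊕ {a} {a'} {b} {b'} {c} eq₁ eq₂ eq₃ = begin
  a' ⊗ (b ⊕ c) ⊕ a ⊗ (b' ⊕ c) ⊕ a' ⊗ (b' ⊕ c)
    ≡⟨ cong₂ _⊕_ (cong₂ _⊕_ eq₁ eq₂) eq₃ ⟩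
  (a' ⊗ b ⊕ a' ⊗ c) ⊕ (a ⊗ b' ⊕ a ⊗ c) ⊕ (a' ⊗ b' ⊕ a' ⊗ c)
    ≡⟨ solve 5 (λ p q r s t → ((p ∔ q) ∔ (r ∔ s)) ∔ (t ∔ q) ⊜ ((((p ∔ r) ∔ t) ∔ s) ∔ q) ∔ q) refl
         (a' ⊗ b) (a' ⊗ c) (a ⊗ b') (a ⊗ c) (a' ⊗ b') ⟩
  nimOption a b a' b' ⊕ a ⊗ c ⊕ a' ⊗ c ⊕ a' ⊗ c
    ≡⟨ ⊕-cancelʳ (nimOption a b a' b' ⊕ a ⊗ c) (a' ⊗ c) ⟩
  nimOption a b a' b' ⊕ a ⊗ c ∎
  where open ≡-Reasoning

distributesAt-comm : ∀ a b c → DistributesAt a b c → DistributesAt a c b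
distributesAt-comm a b c eq =
  trans (cong (a ⊗_) (⊕-comm c b)) (trans eq (⊕-comm (a ⊗ b) (a ⊗ c)))

-- If the two sides differ, the smaller one is an option of the larger one; by the inductive
-- hypotheses it is then also an option of itself in the sense excluded by nimOption≢⊗.
⊗-distribˡ-⊕ : ∀ a b c → DistributesAt a b c
⊗-distribˡ-⊕ = <-rec _ λ a ihᵃ → <-rec _ λ b ihᵇ → <-rec _ λ c ihᶜ →
  ≤-antisym (≮⇒≥ (Step.rhs≮lhs a ihᵃ b c ihᵇ ihᶜ)) (≮⇒≥ (Step.lhs≮rhs a ihᵃ b c ihᵇ ihᶜ))
  where
  module Step (a : ℕ) (ihᵃ : ∀ {a'} → a' < a → ∀ b c → DistributesAt a' b c) where

    optionˡ : ∀ {a' b' b c} → a' < a → DistributesAt a b' c →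
      nimOption a (b ⊕ c) a' (b' ⊕ c) ≡ nimOption a b a' b' ⊕ a ⊗ c
    optionˡ {a'} {b'} {b} {c} a'<a eq = nimOption-⊕ {a} {a'} {b} {b'} {c} (ihᵃ a'<a b c) eq (ihᵃ a'<a b' c)

    option≢ˡ : ∀ {a' b' b c} → a' < a → b' ≢ b → DistributesAt a b' c →
      nimOption a b a' b' ⊕ a ⊗ c ≢ a ⊗ (b ⊕ c)
    option≢ˡ {a'} {b'} {b} {c} a'<a b'≢b eq eq' =
      -- Translation by c can reverse the order of b' and b but keeps them distinct, hence the
      -- version of `option≢⊗` with inequalities only.
      nimOption≢⊗ (<⇒≢ a'<a) (b'≢b ∘ ⊕-injectiveʳ c) (trans (optionˡ a'<a eq) eq')

    ⊗⊕≮ : ∀ b c → (∀ {b'} → b' < b → DistributesAt a b' c) →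
      ¬ (a ⊗ (b ⊕ c) ⊕ a ⊗ c < a ⊗ b)
    ⊗⊕≮ b c ih lt =
      let a' , b' , a'<a , b'<b , eq = <⊗⇒option a b lt
      in option≢ˡ a'<a (<⇒≢ b'<b) (ih b'<b)
           (trans (cong (_⊕ a ⊗ c) (sym eq)) (⊕-cancelʳ (a ⊗ (b ⊕ c)) (a ⊗ c)))

    -- With `d = (d ⊕ c) ⊕ c`, cancelling `a ⊗ c` from the equation would make `a ⊗ b` equal to its
    -- own option at a' and `d ⊕ c`.
    ⊕≢option : ∀ b c → (∀ {b'} → b' < b → DistributesAt a b' c) → ∀ {a' d} → a' < a → d ⊕ c < b →
      a ⊗ b ⊕ a ⊗ c ≢ nimOption a (b ⊕ c) a' d
    ⊕≢option b c ih {a'} {d} a'<a lt eq =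
      option≢⊗ a'<a lt (sym (⊕-injectiveʳ (a ⊗ c) (begin
        a ⊗ b ⊕ a ⊗ c                        ≡⟨ eq ⟩
        nimOption a (b ⊕ c) a' d             ≡⟨ cong (nimOption a (b ⊕ c) a') (⊕-cancelʳ d c) ⟨
        nimOption a (b ⊕ c) a' (d ⊕ c ⊕ c)   ≡⟨ optionˡ a'<a (ih lt) ⟩
        nimOption a b a' (d ⊕ c) ⊕ a ⊗ c     ∎)))
      where open ≡-Reasoning

    module _ (b c : ℕ) (ihᵇ : ∀ {b'} → b' < b → ∀ c → DistributesAt a b' c)
             (ihᶜ : ∀ {c'} → c' < c → DistributesAt a b c') where

      ihᶜ′ : ∀ {c'} → c' < c → DistributesAt a c' b
      ihᶜ′ {c'} c'<c = distributesAt-comm a b c' (ihᶜ c'<c)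

      rhs≮lhs : ¬ (a ⊗ b ⊕ a ⊗ c < a ⊗ (b ⊕ c))
      rhs≮lhs lt with a' , d , a'<a , d< , eq ← <⊗⇒option a (b ⊕ c) lt
        -- Either `d ⊕ c < b` or `b ⊕ d < c`; the second case is the first with b and c
        -- interchanged.
        with <⊕⇒option b c d d<
      ... | inj₁ p = ⊕≢option b c (λ b'<b → ihᵇ b'<b c) a'<a p eq
      ... | inj₂ p = ⊕≢option c b ihᶜ′ a'<a (subst (_< c) (⊕-comm b d) p)
        (trans (⊕-comm (a ⊗ c) (a ⊗ b)) (trans eq (cong (λ s → nimOption a s a' d) (⊕-comm b c))))

      lhs≮rhs : ¬ (a ⊗ (b ⊕ c) < a ⊗ b ⊕ a ⊗ c)
      lhs≮rhs lt with <⊕⇒option (a ⊗ b) (a ⊗ c) (a ⊗ (b ⊕ c)) lt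
      ... | inj₁ p = ⊗⊕≮ b c (λ b'<b → ihᵇ b'<b c) p
      ... | inj₂ p = ⊗⊕≮ c b ihᶜ′
        (subst (_< a ⊗ c) (trans (⊕-comm (a ⊗ b) (a ⊗ (b ⊕ c))) (cong (λ s → a ⊗ s ⊕ a ⊗ b) (⊕-comm b c))) p)

⊗-distribʳ-⊕ : ∀ a b c → (b ⊕ c) ⊗ a ≡ b ⊗ a ⊕ c ⊗ a
⊗-distribʳ-⊕ a b c = begin
  (b ⊕ c) ⊗ a      ≡⟨ ⊗-comm (b ⊕ c) a ⟩
  a ⊗ (b ⊕ c)      ≡⟨ ⊗-distribˡ-⊕ a b c ⟩
  a ⊗ b ⊕ a ⊗ c    ≡⟨ cong₂ _⊕_ (⊗-comm a b) (⊗-comm a c) ⟩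
  b ⊗ a ⊕ c ⊗ a    ∎
  where open ≡-Reasoning

-- The bridge from nim-multiplication to the game: the difference between a product and its option
-- is a product of differences, the same shape as `boxSum`.
nimOption-factor : ∀ a b a' b' → nimOption a b a' b' ⊕ a ⊗ b ≡ (a' ⊕ a) ⊗ (b' ⊕ b)
nimOption-factor a b a' b' = begin
  a' ⊗ b ⊕ a ⊗ b' ⊕ a' ⊗ b' ⊕ a ⊗ b
    ≡⟨ solve 4 (λ p q r s → ((p ∔ q) ∔ r) ∔ s ⊜ (r ∔ p) ∔ (q ∔ s)) refl
         (a' ⊗ b) (a ⊗ b') (a' ⊗ b') (a ⊗ b) ⟩
  (a' ⊗ b' ⊕ a' ⊗ b) ⊕ (a ⊗ b' ⊕ a ⊗ b)
    ≡⟨ cong₂ _⊕_ (⊗-distribˡ-⊕ a' b' b) (⊗-distribˡ-⊕ a b' b) ⟨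
  a' ⊗ (b' ⊕ b) ⊕ a ⊗ (b' ⊕ b)
    ≡⟨ ⊗-distribʳ-⊕ (b' ⊕ b) a' a ⟨
  (a' ⊕ a) ⊗ (b' ⊕ b) ∎
  where open ≡-Reasoning

-- The ruler sequence and the Gray code

v2F-irrelevant : ∀ f g x → x ≤ f → x ≤ g → v2F f x ≡ v2F g x
v2F-irrelevant zero    zero    x le₁ le₂ = refl
v2F-irrelevant zero    (suc g) zero le₁ le₂ = refl
v2F-irrelevant (suc f) zero    zero le₁ le₂ = refl
v2F-irrelevant (suc f) (suc g) zero le₁ le₂ = refl
v2F-irrelevant (suc f) (suc g) x@(suc _) le₁ le₂ =
  cong (λ v → if (x % 2) ≡ᵇ 0 then suc v else 0)
    (v2F-irrelevant f g (x / 2) (s≤s⁻¹ (≤-trans x/2<x le₁)) (s≤s⁻¹ (≤-trans x/2<x le₂)))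
  where x/2<x = m/n<m x 2 ≤-refl

h-odd : ∀ m → h (true ⦂ m) ≡ 1
h-odd m rewrite ⦂-% true m = refl

h-even : ∀ m → h (false ⦂ suc m) ≡ false ⦂ h (suc m)
h-even m rewrite ⦂-% false (suc m) | ⦂-/ false (suc m) =
  cong (λ v → 2 * 2 ^ v) (v2F-irrelevant (m + suc (m + 0)) (suc m) (suc m)
    (≤-trans (m≤n+m (suc m) m) (+-monoʳ-≤ m (s≤s (m≤m+n m 0)))) ≤-refl)

-- The partial nim-sums of the ruler sequence h form the reflected binary Gray code.
gray : ℕ → ℕ
gray zero    = 0
gray (suc n) = gray n ⊕ h (suc n)

odd : ℕ → Bool
odd zero    = false
odd (suc n) = not (odd n)

gray-⦂-true : ∀ m → gray (false ⦂ m) ≡ odd m ⦂ gray m → gray (true ⦂ m) ≡ not (odd m) ⦂ gray m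
gray-⦂-true m eq = begin
  gray (false ⦂ m) ⊕ h (true ⦂ m)    ≡⟨ cong₂ _⊕_ eq (h-odd m) ⟩
  (odd m ⦂ gray m) ⊕ (true ⦂ 0)      ≡⟨ ⊕-⦂ (odd m) true (gray m) 0 ⟩
  (odd m xor true) ⦂ (gray m ⊕ 0)    ≡⟨ cong₂ _⦂_ (xor-comm (odd m) true) (⊕-identityʳ (gray m)) ⟩
  not (odd m) ⦂ gray m          ∎
  where open ≡-Reasoning
-- Among the indices 1 to 2m, the m odd ones contribute 1 each and produce the parity of m as last
-- digit; the even ones contribute `2 * h i` for i up to m and produce `gray m` above it.
gray-⦂-false : ∀ m → gray (false ⦂ m) ≡ odd m ⦂ gray m
gray-⦂-false zero    = refl
gray-⦂-false (suc m) = begin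
  gray (2 * suc m)                              ≡⟨ cong gray (*-suc 2 m) ⟩
  gray (true ⦂ m) ⊕ h (suc (true ⦂ m))          ≡⟨ cong₂ _⊕_ (gray-⦂-true m (gray-⦂-false m))
                                                            (trans (cong h (sym (*-suc 2 m))) (h-even m)) ⟩
  (not (odd m) ⦂ gray m) ⊕ (false ⦂ h (suc m))  ≡⟨ ⊕-⦂ (not (odd m)) false (gray m) (h (suc m)) ⟩
  (not (odd m) xor false) ⦂ gray (suc m)        ≡⟨ cong (_⦂ gray (suc m)) (xor-identityʳ (not (odd m))) ⟩
  odd (suc m) ⦂ gray (suc m)                    ∎
  where open ≡-Reasoning

-- The familiar formula n xor (n / 2) for the Gray code, read digit by digit.
gray-⦂ : ∀ b m → gray (b ⦂ m) ≡ (b xor odd m) ⦂ gray m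
gray-⦂ false m = gray-⦂-false m
gray-⦂ true  m = gray-⦂-true m (gray-⦂-false m)

⦂-injective : ∀ b c m n → b ⦂ m ≡ c ⦂ n → b ≡ c × m ≡ n
⦂-injective b c m n eq = bit-injective b c (trans (sym (⦂-% b m)) (trans (cong (_% 2) eq) (⦂-% c n)))
  , trans (sym (⦂-/ b m)) (trans (cong (_/ 2) eq) (⦂-/ c n))
  where
  bit-injective : ∀ b c → bit b ≡ bit c → b ≡ c
  bit-injective false false _ = refl
  bit-injective true  true  _ = refl

xor-injectiveʳ : ∀ b c d → b xor d ≡ c xor d → b ≡ c
xor-injectiveʳ false false _     _ = refl
xor-injectiveʳ true  true  _     _ = refl
xor-injectiveʳ false true  false ()
xor-injectiveʳ false true  true  ()
xor-injectiveʳ true  false false ()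
xor-injectiveʳ true  false true  ()

-- By induction the leading parts of the arguments agree; then so do their parities, which cancel
-- from the last digit.
gray-injective : ∀ m n → gray m ≡ gray n → m ≡ n
gray-injective = binary-induction _
  (binary-induction _ (λ _ → refl) λ c n ih → step false c 0 n ih)
  λ b m ih n → elim b m ih (binary n)
  where
  step : ∀ b c m n → (gray m ≡ gray n → m ≡ n) → gray (b ⦂ m) ≡ gray (c ⦂ n) → b ⦂ m ≡ c ⦂ n
  step b c m n ih eq
    with eq₁ , eq₂ ← ⦂-injective (b xor odd m) (c xor odd n) (gray m) (gray n)
           (trans (sym (gray-⦂ b m)) (trans eq (gray-⦂ c n)))
    with refl ← ih eq₂ = cong (_⦂ m) (xor-injectiveʳ b c (odd m) eq₁)
  elim : ∀ b m → (∀ n → gray m ≡ gray n → m ≡ n) → ∀ {n} → Binary n →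
         gray (b ⦂ m) ≡ gray n → b ⦂ m ≡ n
  elim b m ih (c ⦂ᵛ n) = step b c m n (ih n)

-- The case of a single prime: all smaller values are reached. For odd x only `c = 0` occurs, and
-- `a = x - 1` serves. For even x the induction hypothesis at `x / 2` fixes the leading part of a,
-- and the last digit of a is adjusted to that of c.
gray-options : ∀ x c → 0 < x → c < h x → ∃ λ a → a < x × gray x ⊕ gray a ≡ c ⊕ h x
gray-options = binary-induction _ (λ _ ()) λ
  { true  m ih c _ c< → oddCase m c c<
  ; false zero ih c () c<
  ; false (suc m) ih c _ c< → evenCase m (λ c' → ih c' z<s) (binary c) c< }
  where
  open ≡-Reasoning
  oddCase : ∀ m c → c < h (true ⦂ m) →
    ∃ λ a → a < true ⦂ m × gray (true ⦂ m) ⊕ gray a ≡ c ⊕ h (true ⦂ m)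
  oddCase m c c< with refl ← n<1⇒n≡0 (subst (c <_) (h-odd m) c<) = false ⦂ m , ≤-refl , (begin
    gray (false ⦂ m) ⊕ h (true ⦂ m) ⊕ gray (false ⦂ m)
      ≡⟨ cong (_⊕ gray (false ⦂ m)) (⊕-comm (gray (false ⦂ m)) (h (true ⦂ m))) ⟩
    h (true ⦂ m) ⊕ gray (false ⦂ m) ⊕ gray (false ⦂ m)
      ≡⟨ ⊕-cancelʳ (h (true ⦂ m)) (gray (false ⦂ m)) ⟩
    h (true ⦂ m)
      ≡⟨ ⊕-identityˡ (h (true ⦂ m)) ⟨
    0 ⊕ h (true ⦂ m) ∎)

  solve-xor : ∀ b c d → b xor (((b xor c) xor d) xor d) ≡ c
  solve-xor false false false = refl
  solve-xor false false true  = refl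
  solve-xor false true  false = refl
  solve-xor false true  true  = refl
  solve-xor true  false false = refl
  solve-xor true  false true  = refl
  solve-xor true  true  false = refl
  solve-xor true  true  true  = refl

  evenCase : ∀ m → (∀ c → c < h (suc m) → ∃ λ a → a < suc m × gray (suc m) ⊕ gray a ≡ c ⊕ h (suc m)) →
    ∀ {c} → Binary c → c < h (false ⦂ suc m) →
    ∃ λ a → a < false ⦂ suc m × gray (false ⦂ suc m) ⊕ gray a ≡ c ⊕ h (false ⦂ suc m)
  -- The last digit of `h` at an even number is 0, so a tie in the leading parts is impossible.
  evenCase m ih (d ⦂ᵛ c) c< with ⦂-<-inv d false c (h (suc m)) (subst (d ⦂ c <_) (h-even m) c<)
  ... | inj₁ c<h with a , a< , eq ← ih c c<h = e ⦂ a , ⦂-mono-< e false a< , (begin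
    gray (false ⦂ suc m) ⊕ gray (e ⦂ a)
      ≡⟨ cong₂ _⊕_ (gray-⦂ false (suc m)) (gray-⦂ e a) ⟩
    (odd (suc m) ⦂ gray (suc m)) ⊕ ((e xor odd a) ⦂ gray a)
      ≡⟨ ⊕-⦂ (odd (suc m)) (e xor odd a) (gray (suc m)) (gray a) ⟩
    (odd (suc m) xor (e xor odd a)) ⦂ (gray (suc m) ⊕ gray a)
      ≡⟨ cong₂ _⦂_ (trans (solve-xor (odd (suc m)) d (odd a)) (sym (xor-identityʳ d))) eq ⟩
    (d xor false) ⦂ (c ⊕ h (suc m))
      ≡⟨ ⊕-⦂ d false c (h (suc m)) ⟨
    (d ⦂ c) ⊕ (false ⦂ h (suc m))
      ≡⟨ cong ((d ⦂ c) ⊕_) (h-even m) ⟨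
    (d ⦂ c) ⊕ h (false ⦂ suc m) ∎)
    -- The solution of `odd (suc m) xor (e xor odd a) ≡ d`.
    where e = (odd (suc m) xor d) xor odd a

-- Exponent vectors of divisors

prime∤⇒coprime : ∀ {p n} → Prime p → p ∤ n → Coprime p n
prime∤⇒coprime pp p∤n (d∣p , d∣n) with prime⇒irreducible pp d∣p
... | inj₁ d≡1  = d≡1
... | inj₂ refl = contradiction d∣n p∤n

prime∣^⇒∣ : ∀ {p q} x → Prime p → p ∣ q ^ x → p ∣ q
prime∣^⇒∣ zero pp p∣1 with refl ← ∣1⇒≡1 p∣1 = contradiction pp ¬prime[1]
prime∣^⇒∣ {q = q} (suc x) pp p∣ = [ id , prime∣^⇒∣ x pp ]′ (euclidsLemma q (q ^ x) pp p∣)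

^-∣⇒≤ : ∀ {p m} a b → Prime p → p ∤ m → p ^ a ∣ p ^ b * m → a ≤ b
^-∣⇒≤ zero    b       pp p∤m div = z≤n
^-∣⇒≤ {p} {m} (suc a) zero    pp p∤m div =
  contradiction (∣-trans (m∣m*n (p ^ a)) (subst (p ^ suc a ∣_) (*-identityˡ m) div)) p∤m
^-∣⇒≤ {p} {m} (suc a) (suc b) pp p∤m div = s≤s (^-∣⇒≤ a b pp p∤m
  (*-cancelˡ-∣ p {{prime⇒nonZero pp}} (subst (p * p ^ a ∣_) (*-assoc p (p ^ b) m) div)))

coprime-to-^-divisor : ∀ {p d m} b → Prime p → p ∤ d → d ∣ p ^ b * m → d ∣ m
coprime-to-^-divisor {d = d} {m} zero pp p∤d div = subst (d ∣_) (*-identityˡ m) div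
coprime-to-^-divisor {p} {d} {m} (suc b) pp p∤d div = coprime-to-^-divisor b pp p∤d
  (coprime-divisor (coprime-sym (prime∤⇒coprime pp p∤d)) (subst (d ∣_) (*-assoc p (p ^ b) m) div))

-- Factors p are removed from d one at a time; once p no longer divides it, what remains is coprime
-- to p and divides m.
∣-^*-split : ∀ {p d m} e → Prime p → d ∣ p ^ e * m → ∃₂ λ t d' → d ≡ p ^ t * d' × d' ∣ m
∣-^*-split {d = d} {m} zero pp div = 0 , d , sym (*-identityˡ d) , subst (d ∣_) (*-identityˡ m) div
∣-^*-split {p} {d} {m} (suc e) pp div with p ∣? d
... | no p∤d = 0 , d , sym (*-identityˡ d) , coprime-to-^-divisor (suc e) pp p∤d div
... | yes (divides q refl)
  with t , d' , refl , d'∣m ← ∣-^*-split {p} {q} {m} e pp (*-cancelˡ-∣ p {{prime⇒nonZero pp}}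
         (subst₂ _∣_ (*-comm q p) (*-assoc p (p ^ e) m) div))
  = suc t , d' , trans (*-comm (p ^ t * d') p) (sym (*-assoc p (p ^ t) d')) , d'∣m

^-monoʳ-∣ : ∀ p {a b} → a ≤ b → p ^ a ∣ p ^ b
^-monoʳ-∣ p {b = b} z≤n = 1∣ (p ^ b)
^-monoʳ-∣ p (s≤s a≤b) = *-monoʳ-∣ p (^-monoʳ-∣ p a≤b)

_≼_ : ∀ {r} → Vec ℕ r → Vec ℕ r → Set
_≼_ = Pointwise _≤_

≼-refl : ∀ {r} {α : Vec ℕ r} → α ≼ α
≼-refl = pointwise-refl ≤-refl

≼-trans : ∀ {r} {α β γ : Vec ℕ r} → α ≼ β → β ≼ γ → α ≼ γ
≼-trans = pointwise-trans ≤-trans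

≼-antisym : ∀ {r} {α β : Vec ℕ r} → α ≼ β → β ≼ α → α ≡ β
≼-antisym [] [] = refl
≼-antisym (a≤b ∷ α≼β) (b≤a ∷ β≼α) = cong₂ _∷_ (≤-antisym a≤b b≤a) (≼-antisym α≼β β≼α)

-- Exponents are vectors rather than functions on `Fin r`, so that coordinatewise equality is
-- equality, as in `≼-antisym`.
fromExponents : ∀ {r} → (Fin r → ℕ) → Vec ℕ r → ℕ
fromExponents p []      = 1
fromExponents p (x ∷ α) = p fzero ^ x * fromExponents (p ∘ fsuc) α

fromExponents-tabulate : ∀ r (p x : Fin r → ℕ) →
  fromExponents p (tabulate x) ≡ prodFin r (λ i → p i ^ x i)
fromExponents-tabulate zero    p x = refl
fromExponents-tabulate (suc r) p x =
  cong (p fzero ^ x fzero *_) (fromExponents-tabulate r (p ∘ fsuc) (x ∘ fsuc))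

fromExponents-mono-∣ : ∀ {r} (p : Fin r → ℕ) {α β} → α ≼ β → fromExponents p α ∣ fromExponents p β
fromExponents-mono-∣ p []            = ∣-refl
fromExponents-mono-∣ p (a≤b ∷ α≼β) =
  *-pres-∣ (^-monoʳ-∣ (p fzero) a≤b) (fromExponents-mono-∣ (p ∘ fsuc) α≼β)

record DistinctPrimes {r : ℕ} (p : Fin r → ℕ) : Set where
  field
    prime    : ∀ i → Prime (p i)
    distinct : ∀ i j → p i ≡ p j → i ≡ j

open DistinctPrimes

tail : ∀ {r} {p : Fin (suc r) → ℕ} → DistinctPrimes p → DistinctPrimes (p ∘ fsuc)
tail dp .prime i         = prime dp (fsuc i)
tail dp .distinct i j eq = Fin.suc-injective (distinct dp (fsuc i) (fsuc j) eq)

fromExponents-nonZero : ∀ {r} {p : Fin r → ℕ} → DistinctPrimes p → ∀ α → NonZero (fromExponents p α)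
fromExponents-nonZero dp []              = _
fromExponents-nonZero {p = p} dp (x ∷ α) =
  m*n≢0 (p fzero ^ x) _ {{m^n≢0 (p fzero) x {{prime⇒nonZero (prime dp fzero)}}}} {{fromExponents-nonZero (tail dp) α}}

prime∤fromExponents : ∀ {r q} {p : Fin r → ℕ} → Prime q → DistinctPrimes p → (∀ i → q ≢ p i) →
  ∀ α → q ∤ fromExponents p α
prime∤fromExponents qp dp q≢ [] q∣1 with refl ← ∣1⇒≡1 q∣1 = ¬prime[1] qp
prime∤fromExponents {p = p} qp dp q≢ (x ∷ α) q∣ with euclidsLemma (p fzero ^ x) _ qp q∣
... | inj₂ q∣α = prime∤fromExponents qp (tail dp) (q≢ ∘ fsuc) α q∣α
... | inj₁ q∣^ with prime⇒irreducible (prime dp fzero) (prime∣^⇒∣ x qp q∣^)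
...   | inj₁ refl = ¬prime[1] qp
...   | inj₂ q≡p  = q≢ fzero q≡p

head∤tail : ∀ {r} {p : Fin (suc r) → ℕ} → DistinctPrimes p → ∀ α → p fzero ∤ fromExponents (p ∘ fsuc) α
head∤tail dp = prime∤fromExponents (prime dp fzero) (tail dp) λ i eq → 0≢suc (distinct dp fzero (fsuc i) eq)
  where
  0≢suc : ∀ {n} {i : Fin n} → fzero ≢ fsuc i
  0≢suc ()

fromExponents-cancel-∣ : ∀ {r} {p : Fin r → ℕ} → DistinctPrimes p → ∀ α β →
  fromExponents p α ∣ fromExponents p β → α ≼ β
fromExponents-cancel-∣ dp [] [] div = []
fromExponents-cancel-∣ {p = p} dp (a ∷ α) (b ∷ β) div =
  ^-∣⇒≤ a b (prime dp fzero) (head∤tail dp β) (∣-trans (m∣m*n _) div)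
  ∷ fromExponents-cancel-∣ (tail dp) α β
      (coprime-to-^-divisor b (prime dp fzero) (head∤tail dp α) (∣-trans (n∣m*n (p fzero ^ a)) div))

fromExponents-injective : ∀ {r} {p : Fin r → ℕ} → DistinctPrimes p → ∀ {α β} →
  fromExponents p α ≡ fromExponents p β → α ≡ β
fromExponents-injective dp {α} {β} eq = ≼-antisym
  (fromExponents-cancel-∣ dp α β (∣-reflexive eq)) (fromExponents-cancel-∣ dp β α (∣-reflexive (sym eq)))

∣fromExponents⇒ : ∀ {r} {p : Fin r → ℕ} → DistinctPrimes p → ∀ ε {d} → d ∣ fromExponents p ε →
  ∃ λ α → d ≡ fromExponents p α
∣fromExponents⇒ dp [] div = [] , ∣1⇒≡1 div
∣fromExponents⇒ {p = p} dp (e ∷ ε) div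
  with t , d' , refl , d'∣ ← ∣-^*-split e (prime dp fzero) div
  with α , refl ← ∣fromExponents⇒ (tail dp) ε d'∣ = t ∷ α , refl

-- Boxes of exponent vectors

-- Listed downwards: the head is the largest element, in step with the recursion of `gray`.
range : ℕ → ℕ → List ℕ
range a b = applyDownFrom (a +_) (suc b ∸ a)

∈-range⁺ : ∀ {a b t} → a ≤ t → t ≤ b → t ∈ range a b
∈-range⁺ {a} {b} {t} a≤t t≤b = subst (_∈ range a b) (m+[n∸m]≡n a≤t)
  (∈-applyDownFrom⁺ (a +_) (∸-monoˡ-< (s≤s t≤b) a≤t))

∈-range⁻ : ∀ {a b t} → t ∈ range a b → a ≤ t × t ≤ b
∈-range⁻ {a} {b} t∈ with i , i< , refl ← ∈-applyDownFrom⁻ (a +_) t∈ =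
  m≤m+n a i , s≤s⁻¹ (m<n∸o⇒o+m<n (suc b) a i<)
  where
  m<n∸o⇒o+m<n : ∀ {m} n o → m < n ∸ o → o + m < n
  m<n∸o⇒o+m<n n       zero    lt = lt
  m<n∸o⇒o+m<n (suc n) (suc o) lt = s≤s (m<n∸o⇒o+m<n n o lt)

range-unique : ∀ a b → Unique (range a b)
range-unique a b = Unique.applyDownFrom⁺₁ (a +_) (suc b ∸ a)
  λ j<i _ eq → <⇒≢ j<i (sym (+-cancelˡ-≡ a _ _ eq))

box : ∀ {r} → Vec ℕ r → Vec ℕ r → List (Vec ℕ r)
box []      []      = [] ∷ []
box (a ∷ α) (b ∷ β) = cartesianProductWith _∷_ (range a b) (box α β)

∈-box⁺ : ∀ {r} {α β γ : Vec ℕ r} → α ≼ γ → γ ≼ β → γ ∈ box α β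
∈-box⁺ [] [] = here refl
∈-box⁺ (a≤c ∷ α≼γ) (c≤b ∷ γ≼β) = ∈-cartesianProductWith⁺ _∷_ (∈-range⁺ a≤c c≤b) (∈-box⁺ α≼γ γ≼β)

∈-box⁻ : ∀ {r} (α β : Vec ℕ r) {γ} → γ ∈ box α β → α ≼ γ × γ ≼ β
∈-box⁻ [] [] (here refl) = [] , []
∈-box⁻ (a ∷ α) (b ∷ β) γ∈
  with c , γ , c∈ , γ∈ , refl ← ∈-cartesianProductWith⁻ _∷_ (range a b) (box α β) γ∈
  with a≤c , c≤b ← ∈-range⁻ {a} {b} c∈ | α≼γ , γ≼β ← ∈-box⁻ α β γ∈
  = a≤c ∷ α≼γ , c≤b ∷ γ≼β

box-unique : ∀ {r} (α β : Vec ℕ r) → Unique (box α β)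
box-unique []      []      = All.[] ∷ []
box-unique (a ∷ α) (b ∷ β) =
  Unique.cartesianProductWith⁺ _∷_ ∷-injective (range-unique a b) (box-unique α β)

-- Nim-sums over boxes

xorList-++ : ∀ xs ys → xorList (xs ++ ys) ≡ xorList xs ⊕ xorList ys
xorList-++ []       ys = sym (⊕-identityˡ (xorList ys))
xorList-++ (x ∷ xs) ys = trans (cong (x ⊕_) (xorList-++ xs ys)) (sym (⊕-assoc x (xorList xs) (xorList ys)))

xorList-↭ : ∀ {xs ys} → xs ↭ ys → xorList xs ≡ xorList ys
xorList-↭ Perm.refl             = refl
xorList-↭ (Perm.prep x xs↭ys)   = cong (x ⊕_) (xorList-↭ xs↭ys)
xorList-↭ (Perm.swap {xs} {ys} x y xs↭ys) = begin
  x ⊕ (y ⊕ xorList xs)  ≡⟨ cong (λ s → x ⊕ (y ⊕ s)) (xorList-↭ xs↭ys) ⟩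
  x ⊕ (y ⊕ xorList ys)  ≡⟨ ⊕-assoc x y (xorList ys) ⟨
  x ⊕ y ⊕ xorList ys    ≡⟨ cong (_⊕ xorList ys) (⊕-comm x y) ⟩
  y ⊕ x ⊕ xorList ys    ≡⟨ ⊕-assoc y x (xorList ys) ⟩
  y ⊕ (x ⊕ xorList ys)  ∎
  where open ≡-Reasoning
xorList-↭ (Perm.trans p q)      = trans (xorList-↭ p) (xorList-↭ q)

xorList-⊗ : ∀ {A : Set} a (f : A → ℕ) xs → xorList (map (λ x → a ⊗ f x) xs) ≡ a ⊗ xorList (map f xs)
xorList-⊗ a f []       = sym (⊗-zeroʳ a)
xorList-⊗ a f (x ∷ xs) = trans (cong (a ⊗ f x ⊕_) (xorList-⊗ a f xs))
  (sym (⊗-distribˡ-⊕ a (f x) (xorList (map f xs))))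

boxGrundy : ∀ {r} → Vec ℕ r → ℕ
boxGrundy []      = 1
boxGrundy (x ∷ α) = h (x + 1) ⊗ boxGrundy α

boxGrundy-tabulate : ∀ r (x : Fin r → ℕ) → boxGrundy (tabulate x) ≡ nimProdFin r (λ i → h (x i + 1))
boxGrundy-tabulate zero    x = refl
boxGrundy-tabulate (suc r) x = cong (h (x fzero + 1) ⊗_) (boxGrundy-tabulate r (x ∘ fsuc))

-- Distributivity on both sides: a sum over a product set is the product of the sums.
xorList-product : ∀ {r} xs (αs : List (Vec ℕ r)) →
  xorList (map boxGrundy (cartesianProductWith _∷_ xs αs))
    ≡ xorList (map (λ x → h (x + 1)) xs) ⊗ xorList (map boxGrundy αs)
xorList-product []       αs = sym (⊗-zeroˡ (xorList (map boxGrundy αs)))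
xorList-product (x ∷ xs) αs = begin
  xorList (map boxGrundy (map (x ∷_) αs ++ rest))
    ≡⟨ cong xorList (map-++ boxGrundy (map (x ∷_) αs) rest) ⟩
  xorList (map boxGrundy (map (x ∷_) αs) ++ map boxGrundy rest)
    ≡⟨ xorList-++ (map boxGrundy (map (x ∷_) αs)) (map boxGrundy rest) ⟩
  xorList (map boxGrundy (map (x ∷_) αs)) ⊕ xorList (map boxGrundy rest)
    ≡⟨ cong₂ _⊕_ (trans (cong xorList (sym (map-∘ αs))) (xorList-⊗ (h (x + 1)) boxGrundy αs)) (xorList-product xs αs) ⟩
  h (x + 1) ⊗ total ⊕ xorList (map (λ x → h (x + 1)) xs) ⊗ total
    ≡⟨ ⊗-distribʳ-⊕ total (h (x + 1)) (xorList (map (λ x → h (x + 1)) xs)) ⟨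
  (h (x + 1) ⊕ xorList (map (λ x → h (x + 1)) xs)) ⊗ total ∎
  where
  open ≡-Reasoning
  rest = cartesianProductWith _∷_ xs αs
  total = xorList (map boxGrundy αs)

-- `gray` consists of partial sums of `h`, and a segment is the difference of two of them, which for
-- nim-sums is again `⊕`.
xorList-applyDownFrom : ∀ a k → xorList (map (λ x → h (x + 1)) (applyDownFrom (a +_) k)) ≡ gray (a + k) ⊕ gray a
xorList-applyDownFrom a zero = sym (trans (cong (λ n → gray n ⊕ gray a) (+-identityʳ a)) (⊕-self (gray a)))
xorList-applyDownFrom a (suc k) = begin
  h (a + k + 1) ⊕ xorList (map (λ x → h (x + 1)) (applyDownFrom (a +_) k))
    ≡⟨ cong₂ _⊕_ (cong h (+-comm (a + k) 1)) (xorList-applyDownFrom a k) ⟩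
  h (suc (a + k)) ⊕ (gray (a + k) ⊕ gray a)
    ≡⟨ ⊕-assoc (h (suc (a + k))) (gray (a + k)) (gray a) ⟨
  h (suc (a + k)) ⊕ gray (a + k) ⊕ gray a
    ≡⟨ cong (_⊕ gray a) (⊕-comm (h (suc (a + k))) (gray (a + k))) ⟩
  gray (suc (a + k)) ⊕ gray a
    ≡⟨ cong (λ n → gray n ⊕ gray a) (+-suc a k) ⟨
  gray (a + suc k) ⊕ gray a ∎
  where open ≡-Reasoning

-- Closed form of the nim-sum of `boxGrundy` over the whole box, top corner included; see
-- `xorList-box`.
boxSum : ∀ {r} → Vec ℕ r → Vec ℕ r → ℕ
boxSum []      []      = 1
boxSum (a ∷ α) (b ∷ β) = (gray (suc b) ⊕ gray a) ⊗ boxSum α β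

xorList-box : ∀ {r} {α β : Vec ℕ r} → α ≼ β → xorList (map boxGrundy (box α β)) ≡ boxSum α β
xorList-box [] = refl
xorList-box {α = a ∷ α} {b ∷ β} (a≤b ∷ α≼β) = trans
  (xorList-product (range a b) (box α β))
  (cong₂ _⊗_ (trans (xorList-applyDownFrom a (suc b ∸ a))
                    (cong (λ n → gray n ⊕ gray a) (m+[n∸m]≡n (m≤n⇒m≤1+n a≤b))))
             (xorList-box α≼β))

-- No factor vanishes, since `gray` is injective and `a < suc b`, and nim-multiplication has no zero
-- divisors.
boxSum≢0 : ∀ {r} {α β : Vec ℕ r} → α ≼ β → boxSum α β ≢ 0
boxSum≢0 [] ()
boxSum≢0 {α = a ∷ α} {b ∷ β} (a≤b ∷ α≼β) =
  ⊗-nonzero (λ eq → <⇒≢ (s≤s a≤b) (sym (gray-injective (suc b) a (⊕≡0⇒≡ eq)))) (boxSum≢0 α≼β)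

-- As an option of `h (b + 1) ⊗ boxGrundy β`, c comes from some u and v. The first coordinate
-- realises u by `gray-options`, the others realise v by induction, and `nimOption-factor`
-- multiplies the two.
boxSum-options : ∀ {r} (β : Vec ℕ r) {c} → c < boxGrundy β → ∃ λ α → α ≼ β × boxSum α β ≡ c ⊕ boxGrundy β
boxSum-options [] (s≤s z≤n) = [] , [] , refl
boxSum-options (b ∷ β) {c} c<
  with u , v , u< , v< , refl ← <⊗⇒option (h (b + 1)) (boxGrundy β) c<
  with a , a< , eqᵃ ← gray-options (suc b) u z<s (subst (λ n → u < h n) (+-comm b 1) u<)
  with α , α≼β , eqᵅ ← boxSum-options β v<
  = a ∷ α , s≤s⁻¹ a< ∷ α≼β , (begin
    (gray (suc b) ⊕ gray a) ⊗ boxSum α β          ≡⟨ cong₂ _⊗_ eqᵃ eqᵅ ⟩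
    (u ⊕ h (suc b)) ⊗ (v ⊕ boxGrundy β)           ≡⟨ cong (λ n → (u ⊕ h n) ⊗ (v ⊕ boxGrundy β)) (+-comm b 1) ⟨
    (u ⊕ h (b + 1)) ⊗ (v ⊕ boxGrundy β)           ≡⟨ nimOption-factor (h (b + 1)) (boxGrundy β) u v ⟨
    nimOption (h (b + 1)) (boxGrundy β) u v ⊕ h (b + 1) ⊗ boxGrundy β ∎)
  where open ≡-Reasoning

-- The ruler game

∈-divisors⁺ : ∀ {n d} .{{_ : NonZero n}} → d ∣ n → d ∈ divisors n
∈-divisors⁺ {n} {zero}  0∣n = contradiction (0∣⇒≡0 0∣n) (≢-nonZero⁻¹ n)
∈-divisors⁺ {n} {suc d} d∣n = ∈-filter⁺ (_∣? n) (∈-applyUpTo⁺ suc (∣⇒≤ d∣n)) d∣n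

∈-divisors⁻ : ∀ n {d} → d ∈ divisors n → d ∣ n
∈-divisors⁻ n d∈ = proj₂ (∈-filter⁻ (_∣? n) {xs = applyUpTo suc n} d∈)

divisors-unique : ∀ n → Unique (divisors n)
divisors-unique n = Unique.filter⁺ (_∣? n)
  (Unique.applyUpTo⁺₁ suc n λ i<j _ eq → <⇒≢ i<j (cong pred eq))

module Ruler {r : ℕ} {p : Fin r → ℕ} (dp : DistinctPrimes p) (ε : Vec ℕ r) where

  ⟦_⟧ : Vec ℕ r → ℕ
  ⟦_⟧ = fromExponents p

  n : ℕ
  n = ⟦ ε ⟧

  properInterval : ℕ → ℕ → List ℕ
  properInterval a b = filter (λ t → (a ∣? t) ×-dec ((t ∣? b) ×-dec ¬? (t ≟ b))) (divisors n)

  ∈-properInterval⁻ : ∀ a b {t} → t ∈ properInterval a b → t ∣ n × a ∣ t × t ∣ b × t ≢ b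
  ∈-properInterval⁻ a b t∈ =
    let t∈n , props = ∈-filter⁻ (λ t → (a ∣? t) ×-dec ((t ∣? b) ×-dec ¬? (t ≟ b))) {xs = divisors n} t∈
    in ∈-divisors⁻ n t∈n , props

  properInterval-unique : ∀ a b → Unique (properInterval a b)
  properInterval-unique a b = Unique.filter⁺ _ (divisors-unique n)

  -- Both lists are free of repetitions and have the same members. Putting `⟦ β ⟧` back completes
  -- the interval.
  interval-↭-box : ∀ {α β} → α ≼ β → β ≼ ε →
    ⟦ β ⟧ ∷ properInterval ⟦ α ⟧ ⟦ β ⟧ ↭ map ⟦_⟧ (box α β)
  interval-↭-box {α} {β} α≼β β≼ε = ∼bag⇒↭ (unique∧set⇒bag
    (All.tabulate (λ t∈ eq → proj₂ (proj₂ (proj₂ (∈-properInterval⁻ ⟦ α ⟧ ⟦ β ⟧ t∈))) (sym eq))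
      ∷ properInterval-unique ⟦ α ⟧ ⟦ β ⟧)
    (Unique.map⁺ (fromExponents-injective dp) (box-unique α β))
    (mk⇔ to from))
    where
    to : ∀ {t} → t ∈ ⟦ β ⟧ ∷ properInterval ⟦ α ⟧ ⟦ β ⟧ → t ∈ map ⟦_⟧ (box α β)
    to (here refl) = ∈-map⁺ ⟦_⟧ (∈-box⁺ α≼β (≼-refl))
    to (there t∈)
      with t∣n , α∣t , t∣β , _ ← ∈-properInterval⁻ ⟦ α ⟧ ⟦ β ⟧ t∈
      with γ , refl ← ∣fromExponents⇒ dp ε t∣n
      = ∈-map⁺ ⟦_⟧ (∈-box⁺ (fromExponents-cancel-∣ dp α γ α∣t) (fromExponents-cancel-∣ dp γ β t∣β))
    from : ∀ {t} → t ∈ map ⟦_⟧ (box α β) → t ∈ ⟦ β ⟧ ∷ properInterval ⟦ α ⟧ ⟦ β ⟧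
    from t∈ with γ , γ∈ , refl ← ∈-map⁻ ⟦_⟧ t∈
      with α≼γ , γ≼β ← ∈-box⁻ α β γ∈
      with ⟦ γ ⟧ ≟ ⟦ β ⟧
    ... | yes eq = here eq
    ... | no neq = there (∈-filter⁺ _
      (∈-divisors⁺ {{fromExponents-nonZero dp ε}} (fromExponents-mono-∣ p (≼-trans γ≼β β≼ε)))
      (fromExponents-mono-∣ p α≼γ , fromExponents-mono-∣ p γ≼β , neq))

  -- Adding the value of the top to that of the move gives the sum over the full box, known from
  -- `xorList-box`. A general g covers `rulerGrundyF f n` for any fuel.
  move-value : ∀ (g : ℕ → ℕ) {α β} → α ≼ β → β ≼ ε →
    (∀ {γ} → γ ≼ β → ⟦ γ ⟧ ≢ ⟦ β ⟧ → g ⟦ γ ⟧ ≡ boxGrundy γ) →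
    boxGrundy β ⊕ xorList (map g (properInterval ⟦ α ⟧ ⟦ β ⟧)) ≡ boxSum α β
  move-value g {α} {β} α≼β β≼ε g≡ = begin
    boxGrundy β ⊕ xorList (map g I)
      ≡⟨ cong₂ _⊕_ (sym (g′-β (≼-refl))) (cong xorList (map-cong-local (All.tabulate g≡g′))) ⟩
    xorList (map g′ (⟦ β ⟧ ∷ I))
      ≡⟨ xorList-↭ (Perm.map⁺ g′ (interval-↭-box α≼β β≼ε)) ⟩
    xorList (map g′ (map ⟦_⟧ (box α β)))
      ≡⟨ cong xorList (map-∘ (box α β)) ⟨
    xorList (map (g′ ∘ ⟦_⟧) (box α β))
      ≡⟨ cong xorList (map-cong-local (All.tabulate λ γ∈ → g′-β (proj₂ (∈-box⁻ α β γ∈)))) ⟩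
    xorList (map boxGrundy (box α β))
      ≡⟨ xorList-box α≼β ⟩
    boxSum α β ∎
    where
    open ≡-Reasoning
    I = properInterval ⟦ α ⟧ ⟦ β ⟧
    -- g need not be correct at β itself, where the recursion runs out of fuel.
    g′ : ℕ → ℕ
    g′ t with t ≟ ⟦ β ⟧
    ... | yes _ = boxGrundy β
    ... | no  _ = g t
    g′-β : ∀ {γ} → γ ≼ β → g′ ⟦ γ ⟧ ≡ boxGrundy γ
    g′-β {γ} γ≼β with ⟦ γ ⟧ ≟ ⟦ β ⟧
    ... | yes eq = cong boxGrundy (sym (fromExponents-injective dp {γ} {β} eq))
    ... | no neq = g≡ γ≼β neq
    g≡g′ : ∀ {t} → t ∈ I → g t ≡ g′ t
    g≡g′ {t} t∈ with t ≟ ⟦ β ⟧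
    ... | yes eq = contradiction eq (proj₂ (proj₂ (proj₂ (∈-properInterval⁻ ⟦ α ⟧ ⟦ β ⟧ t∈))))
    ... | no _   = refl

  -- Induction on the fuel: a proper divisor of `⟦ β ⟧` is strictly smaller, so one unit less
  -- suffices for it. The mex is then settled by `boxSum≢0` and `boxSum-options`.
  rulerGrundyF≡boxGrundy : ∀ f {β} → β ≼ ε → ⟦ β ⟧ ≤ f → rulerGrundyF f n ⟦ β ⟧ ≡ boxGrundy β
  rulerGrundyF≡boxGrundy zero {β} β≼ε le =
    contradiction (n≤0⇒n≡0 le) (≢-nonZero⁻¹ ⟦ β ⟧ {{fromExponents-nonZero dp β}})
  rulerGrundyF≡boxGrundy (suc f) {β} β≼ε le = mex-unique (map value moves) grundy∉ below∈
    where
    moves : List ℕ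
    moves = filter (_∣? ⟦ β ⟧) (divisors n)
    value : ℕ → ℕ
    value a = xorList (map (rulerGrundyF f n) (properInterval a ⟦ β ⟧))
    value-⟦⟧ : ∀ {α} → α ≼ β → boxGrundy β ⊕ value ⟦ α ⟧ ≡ boxSum α β
    value-⟦⟧ α≼β = move-value (rulerGrundyF f n) α≼β β≼ε λ {γ} γ≼β neq →
      rulerGrundyF≡boxGrundy f (≼-trans γ≼β β≼ε)
        (s≤s⁻¹ (≤-trans (≤∧≢⇒< (∣⇒≤ {{fromExponents-nonZero dp β}} (fromExponents-mono-∣ p γ≼β)) neq) le))
    grundy∉ : boxGrundy β ∉ map value moves
    grundy∉ g∈ with a , a∈ , eq ← ∈-map⁻ value g∈
      with a∈n , a∣β ← ∈-filter⁻ (_∣? ⟦ β ⟧) {xs = divisors n} a∈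
      with α , refl ← ∣fromExponents⇒ dp ε (∈-divisors⁻ n a∈n)
      with α≼β ← fromExponents-cancel-∣ dp α β a∣β
      -- A move that preserved the value would have `boxSum α β ≡ 0`.
      = boxSum≢0 α≼β (trans (sym (value-⟦⟧ α≼β))
          (trans (cong (boxGrundy β ⊕_) (sym eq)) (⊕-self (boxGrundy β))))
    below∈ : ∀ {c} → c < boxGrundy β → c ∈ map value moves
    below∈ {c} c< with α , α≼β , eq ← boxSum-options β c< =
      subst (_∈ map value moves) value≡c (∈-map⁺ value (∈-filter⁺ (_∣? ⟦ β ⟧)
        (∈-divisors⁺ {{fromExponents-nonZero dp ε}} (fromExponents-mono-∣ p (≼-trans α≼β β≼ε)))
        (fromExponents-mono-∣ p α≼β)))
      where
      value≡c : value ⟦ α ⟧ ≡ c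
      value≡c = ⊕-injectiveʳ (boxGrundy β)
        (trans (⊕-comm (value ⟦ α ⟧) (boxGrundy β)) (trans (value-⟦⟧ α≼β) eq))

mainTheorem2 : (r : ℕ) (p e : Fin r → ℕ)
    → (∀ i → Prime (p i))
    → (∀ i j → p i ≡ p j → i ≡ j)
    → (∀ i → 1 ≤ e i)
    → (x : Fin r → ℕ)
    → (∀ i → x i ≤ e i)
    → rulerGrundy (prodFin r (λ i → p i ^ e i)) (prodFin r (λ i → p i ^ x i))
    ≡ nimProdFin r (λ i → h (x i + 1))
mainTheorem2 r p e primes distinct _ x x≤e = begin
  rulerGrundy (prodFin r (λ i → p i ^ e i)) (prodFin r (λ i → p i ^ x i))
    ≡⟨ cong₂ rulerGrundy (fromExponents-tabulate r p e) (fromExponents-tabulate r p x) ⟨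
  rulerGrundy (fromExponents p (tabulate e)) (fromExponents p (tabulate x))
    -- `rulerGrundy` takes the divisor itself as fuel, so the fuel bound is `≤-refl`.
    ≡⟨ Ruler.rulerGrundyF≡boxGrundy (record { prime = primes ; distinct = distinct }) (tabulate e)
         (fromExponents p (tabulate x)) (tabulate⁺ x≤e) ≤-refl ⟩
  boxGrundy (tabulate x)
    ≡⟨ boxGrundy-tabulate r x ⟩
  nimProdFin r (λ i → h (x i + 1)) ∎
  where open ≡-Reasoning
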